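{- There exists $n_0$ such that for all $n \ge n_0$ the following holds. Let $r < n/2 - 7$, let $L_1, L_2, L_3 \colon \mathbb{F}_2^n \to \mathbb{F}_2^n$ be invertible linear maps, and let $x_1, x_2, x_3 \in \mathbb{F}_2^n$. Then $L_1 B_r(x_1) \cup L_2 B_r(x_2) \cup L_3 B_r(x_3) \neq \mathbb{F}_2^n$; that is, $\mathbb{F}_2^n$ cannot be covered by three Hamming balls of radius $r$ relative to different bases.
   Context: For $x, y \in \mathbb{F}_2^n$, $d(x,y)$ denotes the Hamming distance, i.e. the number of indices $i \in \{1,\dots,n\}$ with $x_i \neq y_i$. For a real number $r$, $B_r(x) = \{y \in \mathbb{F}_2^n : d(x,y) \le r\}$ is the Hamming ball of radius $r$ around $x$. For a linear map $L \colon \mathbb{F}_2^n \to \mathbb{F}_2^n$, $L B_r(x) = \{Ly : y \in B_r(x)\}$; for invertible $L$ this is a Hamming ball of radius $r$ relative to the basis given by the columns of the matrix of $L$. -}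

module Defs where

open import Algebra.Module.Bundles.Raw using (RawLeftModule)
open import Algebra.Module.Morphism.Structures using (IsLeftModuleIsomorphism)
open import Data.Bool using (Bool; false; _xor_; _∧_; _≟_)
open import Data.Integer using (+_; -<+; +<+)
open import Data.Nat using (ℕ; s≤s; z≤n)
open import Data.Product using (_×_; _,_; ∃-syntax)
open import Data.Rational as ℚ using (ℚ; _/_; 1ℚ)
open import Data.Rational.Properties using (<-dense; <-trans; <-asym; ≤-<-trans; +-monoʳ-<; +-identityʳ; ≮⇒≥)
open import Data.Sum using (_⊎_; inj₁; inj₂)
open import Data.Vec using (Vec; map; zipWith; replicate; lookup; count; allFin)
open import Function using (id)
open import Level using (0ℓ)
open import Relation.Binary.PropositionalEquality using (_≡_; subst)
open import Relation.Nullary using (¬_; ¬?; yes; no)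
open import Relation.Unary using (Pred; _∈_)

-- Two-sided Dedekind cuts: q ∈ lower means q < x, q ∈ upper means x < q.
record ℝ : Set₁ where
  field
    lower upper     : Pred ℚ 0ℓ
    lower-inhabited : ∃[ q ] q ∈ lower
    upper-inhabited : ∃[ q ] q ∈ upper
    lower-closed    : ∀ {p q} → p ℚ.< q → q ∈ lower → p ∈ lower
    upper-closed    : ∀ {p q} → p ℚ.< q → p ∈ upper → q ∈ upper
    lower-open      : ∀ {p} → p ∈ lower → ∃[ q ] p ℚ.< q × q ∈ lower
    upper-open      : ∀ {q} → q ∈ upper → ∃[ p ] p ℚ.< q × p ∈ upper
    disjoint        : ∀ {q} → ¬ (q ∈ lower × q ∈ upper)
    located         : ∀ {p q} → p ℚ.< q → p ∈ lower ⊎ q ∈ upper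

open ℝ public

infix 4 _<ℝ_ _≤ℝ_

_<ℝ_ : ℝ → ℝ → Set
x <ℝ y = ∃[ q ] q ∈ upper x × q ∈ lower y

_≤ℝ_ : ℝ → ℝ → Set
x ≤ℝ y = ¬ (y <ℝ x)

private
  p-1<p : ∀ p → p ℚ.+ ℚ.- 1ℚ ℚ.< p
  p-1<p p = subst (p ℚ.+ ℚ.- 1ℚ ℚ.<_) (+-identityʳ p) (+-monoʳ-< p (ℚ.*<* -<+))

  p<p+1 : ∀ p → p ℚ.< p ℚ.+ 1ℚ
  p<p+1 p = subst (ℚ._< p ℚ.+ 1ℚ) (+-identityʳ p) (+-monoʳ-< p (ℚ.*<* (+<+ (s≤s z≤n))))

fromℚ : ℚ → ℝ
fromℚ a = record
  { lower           = ℚ._< a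
  ; upper           = a ℚ.<_
  ; lower-inhabited = a ℚ.+ ℚ.- 1ℚ , p-1<p a
  ; upper-inhabited = a ℚ.+ 1ℚ , p<p+1 a
  ; lower-closed    = <-trans
  ; upper-closed    = λ p<q a<p → <-trans a<p p<q
  ; lower-open      = <-dense
  ; upper-open      = λ a<q → let (p , a<p , p<q) = <-dense a<q in p , p<q , a<p
  ; disjoint        = λ (q<a , a<q) → <-asym q<a a<q
  ; located         = loc
  }
  where
  loc : ∀ {p q} → p ℚ.< q → p ℚ.< a ⊎ a ℚ.< q
  loc {p} p<q with p ℚ.<? a
  ... | yes p<a = inj₁ p<a
  ... | no  p≮a = inj₂ (≤-<-trans (≮⇒≥ p≮a) p<q)

fromℕ : ℕ → ℝ
fromℕ m = fromℚ (+ m / 1)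

-- The field with two elements is Bool with addition _xor_ and multiplication
-- _∧_ (Data.Bool.Properties.xor-∧-commutativeRing); negation is the identity.
𝔽₂ : Set
𝔽₂ = Bool

𝔽₂^ : ℕ → Set
𝔽₂^ n = Vec 𝔽₂ n

𝔽₂^-rawLeftModule : ℕ → RawLeftModule 𝔽₂ 0ℓ 0ℓ
𝔽₂^-rawLeftModule n = record
  { Carrierᴹ = 𝔽₂^ n
  ; _≈ᴹ_     = _≡_
  ; _+ᴹ_     = zipWith _xor_
  ; _*ₗ_     = λ c → map (c ∧_)
  ; 0ᴹ       = replicate n false
  ; -ᴹ_      = id
  }

IsInvertibleLinear : ∀ {n} → (𝔽₂^ n → 𝔽₂^ n) → Set
IsInvertibleLinear {n} = IsLeftModuleIsomorphism (𝔽₂^-rawLeftModule n) (𝔽₂^-rawLeftModule n)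

d : ∀ {n} → 𝔽₂^ n → 𝔽₂^ n → ℕ
d {n} x y = count (λ i → ¬? (lookup x i ≟ lookup y i)) (allFin n)

B : ∀ {n} → ℝ → 𝔽₂^ n → Pred (𝔽₂^ n) 0ℓ
B r x y = fromℕ (d x y) ≤ℝ r

image : {A C : Set} → (A → C) → Pred A 0ℓ → Pred C 0ℓ
image f P z = ∃[ y ] y ∈ P × f y ≡ z

{-# OPTIONS --safe #-}

-- Let Mᵢ = Lᵢ⁻¹ and let u be the vector with M₃ u = (1,…,1).  Translation by u
-- replaces d(x₃, M₃ y) by n − d(x₃, M₃ y), so it suffices to find y such that both
-- y and y + u are far from the first two centres.  Among the coordinate functionals
-- of M₁ (and likewise of M₂) choose some that vanish at u, prescribing their values
-- so that they disagree with x₁ at y, and disjoint pairs of functionals that are 1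
-- at u, prescribing the sum of each pair so that exactly one of the two disagrees;
-- both conditions survive translation by u.  If about n/2 such conditions per map
-- can be chosen with all the functionals and pair sums linearly independent, the
-- resulting linear system has a solution.
--
-- For independence, extend E₀ (the functionals of M₁ vanishing at u) by functionals
-- X of M₂ to a basis, let C consist of half of each of the four parts into which X
-- and u split the functionals of M₂, and extend C first by A₀ ⊆ E₀ and then by
-- A₁ ⊆ E₁ (the functionals of M₁ not in E₀) to a basis.  Counting dimensions gives
-- |A₀| ≳ |E₀|/2, and A₁ as well as the part of C not vanishing at u can be traded for
-- almost as many disjoint pairs by an exchange argument.

module Submission where

open import Defs
open import Algebra.Bundles using (CommutativeMonoid)
open import Algebra.Module.Morphism.Structures using (module LeftModuleMorphisms)
import Algebra.Properties.CommutativeSemigroup as CommutativeSemigroup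
open import Data.Bool using (Bool; true; false; not; _xor_; _≟_; if_then_else_)
open import Data.Bool.Properties using (xor-same; xor-identityʳ; xor-comm; xor-assoc)
open import Data.Empty using (⊥-elim)
open import Data.Fin using (Fin; zero; suc)
open import Data.Integer as ℤ using (+_; -[1+_])
import Data.Integer.Properties as ℤ
import Data.Integer.Tactic.RingSolver as ℤ
open import Data.List using (List; []; _∷_; _++_; length; map; allFin; tabulate)
open import Data.List.Properties using (length-++; length-map; length-tabulate; map-++; map-∘; ++-assoc)
open import Data.List.Relation.Binary.Permutation.Propositional using (_↭_; refl; prep; swap; trans; ↭-sym; ↭-reflexive)
open import Data.List.Relation.Binary.Permutation.Propositional.Properties using (All-resp-↭; ↭-length; shift; shifts; ++⁺; ++⁺ˡ; ++⁺ʳ; map⁺; ++-comm; ++-commutativeMonoid)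
open import Data.List.Relation.Unary.All as All using (All; []; _∷_)
import Data.List.Relation.Unary.All.Properties as All
open import Data.List.Relation.Unary.AllPairs using ([]; _∷_)
open import Data.List.Relation.Unary.Unique.Propositional using (Unique)
open import Data.List.Relation.Unary.Unique.Propositional.Properties using (allFin⁺)
open import Data.Nat using (ℕ; zero; suc; _+_; _*_; _≤_; _≥_; z≤n; s≤s)
open import Data.Nat.Properties using (≤-refl; ≤-trans; ≤-reflexive; ≤-total; n≤1+n; m≤n+m; suc-injective; +-suc; +-comm; +-identityʳ; *-suc; +-cancelʳ-≤; +-mono-≤; +-monoˡ-≤; +-monoʳ-≤; *-monoʳ-≤; module ≤-Reasoning)
open import Data.Nat.Tactic.RingSolver using (solve-∀)
open import Data.Product using (_×_; _,_; ∃₂; ∃-syntax; proj₁; proj₂)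
open import Data.Rational as ℚ using (_/_; _-_; toℚᵘ)
import Data.Rational.Properties as ℚ
open import Data.Rational.Unnormalised as ℚᵘ using (mkℚᵘ; *≤*)
import Data.Rational.Unnormalised.Properties as ℚᵘ
open import Data.Sum using (_⊎_; inj₁; inj₂; [_,_]′)
open import Data.Unit using (⊤; tt)
open import Data.Vec as Vec using ([]; _∷_; lookup; replicate; zipWith; _[_]≔_)
open import Data.Vec.Properties using (lookup∘update; lookup∘update′; lookup-replicate; lookup-zipWith)
open import Function using (_∘_; id; case_of_)
open import Relation.Binary.PropositionalEquality as ≡ using (_≡_; _≢_; _≗_; refl; sym; cong; cong₂; subst)
open import Relation.Nullary using (¬_; ¬?; Dec; yes; no)
open import Relation.Unary using (Decidable; _∈_; _∪_; _≐_; U)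

private
  variable
    n : ℕ
    I : Set

-- Linear algebra of functionals over 𝔽₂.

xor-cancelʳ : ∀ a b → (a xor b) xor b ≡ a
xor-cancelʳ a b = ≡.trans (xor-assoc a b b) (≡.trans (cong (a xor_) (xor-same b)) (xor-identityʳ a))

xor-right-comm : ∀ a b c → (a xor c) xor b ≡ (a xor b) xor c
xor-right-comm a b c =
  ≡.trans (xor-assoc a c b) (≡.trans (cong (a xor_) (xor-comm c b)) (sym (xor-assoc a b c)))

xor-telescope : ∀ a b c → (a xor b) xor (b xor c) ≡ a xor c
xor-telescope a b c = ≡.trans (sym (xor-assoc (a xor b) b c)) (cong (_xor c) (xor-cancelʳ a b))

xor-cancel-common : ∀ a b c → (a xor c) xor (b xor c) ≡ a xor b
xor-cancel-common a b c = ≡.trans (cong ((a xor c) xor_) (xor-comm b c)) (xor-telescope a c b)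

xor-interchange : ∀ a b c d → (a xor b) xor (c xor d) ≡ (a xor c) xor (b xor d)
xor-interchange a b c d = ≡.trans (sym (xor-assoc (a xor b) c d))
  (≡.trans (cong (_xor d) (xor-right-comm a c b)) (xor-assoc (a xor c) b d))

Functional : ℕ → Set
Functional n = 𝔽₂^ n → 𝔽₂

infixl 6 _⊕_ _⊞_

_⊕_ : Functional n → Functional n → Functional n
(φ ⊕ ψ) y = φ y xor ψ y

_⊞_ : 𝔽₂^ n → 𝔽₂^ n → 𝔽₂^ n
_⊞_ = zipWith _xor_

Linear : Functional n → Set
Linear φ = ∀ y z → φ (y ⊞ z) ≡ φ y xor φ z

-- Over 𝔽₂ a linear combination is a subset sum, so every list entry is either skipped or added
-- once. The base case asks for pointwise vanishing because functionals are plain functions,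
-- compared by `≗`.
data Span {n} : List (Functional n) → Functional n → Set where
  none : ∀ {φ} → φ ≗ (λ _ → false) → Span [] φ
  skip : ∀ {ψ ψs φ} → Span ψs φ → Span (ψ ∷ ψs) φ
  use  : ∀ {ψ ψs φ} → Span ψs (φ ⊕ ψ) → Span (ψ ∷ ψs) φ

Indep : List (Functional n) → Set
Indep []       = ⊤
Indep (φ ∷ φs) = ¬ Span φs φ × Indep φs

private
  variable
    φ ψ : Functional n
    φs ψs : List (Functional n)

Span-resp-≗ : φ ≗ ψ → Span φs φ → Span φs ψ
Span-resp-≗ eq (none z) = none (λ y → ≡.trans (sym (eq y)) (z y))
Span-resp-≗ eq (skip s) = skip (Span-resp-≗ eq s)
Span-resp-≗ eq (use s)  = use (Span-resp-≗ (λ y → cong (_xor _) (eq y)) s)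

Span-zero : φ ≗ (λ _ → false) → Span φs φ
Span-zero {φs = []}    z = none z
Span-zero {φs = _ ∷ _} z = skip (Span-zero z)

Span-⊕ : Span φs φ → Span φs ψ → Span φs (φ ⊕ ψ)
Span-⊕ (none z) (none z′) = none (λ y → cong₂ _xor_ (z y) (z′ y))
Span-⊕ (skip s) (skip t)  = skip (Span-⊕ s t)
Span-⊕ {φ = φ} {ψ} (skip s) (use {χ} t) = use (Span-resp-≗
  (λ y → sym (xor-assoc (φ y) (ψ y) (χ y))) (Span-⊕ s t))
Span-⊕ {φ = φ} {ψ} (use {χ} s) (skip t) = use (Span-resp-≗
  (λ y → xor-right-comm (φ y) (ψ y) (χ y)) (Span-⊕ s t))
Span-⊕ {φ = φ} {ψ} (use {χ} s) (use t) = skip (Span-resp-≗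
  (λ y → xor-cancel-common (φ y) (ψ y) (χ y)) (Span-⊕ s t))

Span-⊕⁻ʳ : Span φs (φ ⊕ ψ) → Span φs ψ → Span φs φ
Span-⊕⁻ʳ {φ = φ} {ψ} s t = Span-resp-≗
  (λ y → xor-cancelʳ (φ y) (ψ y)) (Span-⊕ s t)

Span-⊕-comm : ∀ φ ψ → Span φs (φ ⊕ ψ) → Span φs (ψ ⊕ φ)
Span-⊕-comm φ ψ = Span-resp-≗ (λ y → xor-comm (φ y) (ψ y))

Span-⊕-trans : ∀ φ ψ χ → Span φs (φ ⊕ ψ) → Span φs (ψ ⊕ χ) → Span φs (φ ⊕ χ)
Span-⊕-trans φ ψ χ s t = Span-resp-≗
  (λ y → xor-telescope (φ y) (ψ y) (χ y)) (Span-⊕ s t)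

Span-self : (φs : List (Functional n)) → All (Span φs) φs
Span-self []       = []
Span-self (φ ∷ φs) = use (Span-zero (λ y → xor-same (φ y))) ∷ All.map skip (Span-self φs)

Span-mono : All (Span ψs) φs → Span φs φ → Span ψs φ
Span-mono []       (none z) = Span-zero z
Span-mono (_ ∷ ss) (skip t) = Span-mono ss t
Span-mono (s ∷ ss) (use t)  = Span-⊕⁻ʳ (Span-mono ss t) s

Span-resp-↭ : φs ↭ ψs → Span φs φ → Span ψs φ
Span-resp-↭ {ψs = ψs} p = Span-mono (All-resp-↭ (↭-sym p) (Span-self ψs))

Span-++ʳ : ∀ φs → Span ψs φ → Span (φs ++ ψs) φ
Span-++ʳ []       s = s
Span-++ʳ (_ ∷ φs) s = skip (Span-++ʳ φs s)

Span-vanishes : ∀ {y} → All (λ ψ → ψ y ≡ false) ψs → Span ψs φ → φ y ≡ false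
Span-vanishes         []       (none z) = z _
Span-vanishes         (_ ∷ vs) (skip s) = Span-vanishes vs s
Span-vanishes {φ = φ} {y = y} (v ∷ vs) (use s) = ≡.trans
  (≡.trans (sym (xor-identityʳ (φ y))) (cong (φ y xor_) (sym v))) (Span-vanishes vs s)

-- There are finitely many vectors, so exhaustive search decides. Through `Span?` this makes the
-- later greedy extensions and matchings explicit algorithms.
search : (φ : Functional n) → φ ≗ (λ _ → false) ⊎ ∃[ y ] φ y ≡ true
search {zero} φ with φ [] in eq
... | false = inj₁ λ { [] → eq }
... | true  = inj₂ ([] , eq)
search {suc n} φ with search (φ ∘ (false ∷_)) | search (φ ∘ (true ∷_))
... | inj₂ (y , p) | _            = inj₂ (_ , p)
... | inj₁ _       | inj₂ (y , p) = inj₂ (_ , p)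
... | inj₁ p       | inj₁ q       = inj₁ λ { (false ∷ y) → p y ; (true ∷ y) → q y }

Span? : (φs : List (Functional n)) (φ : Functional n) → Dec (Span φs φ)
Span? [] φ with search φ
... | inj₁ z       = yes (none z)
... | inj₂ (y , p) = no λ { (none z) → case ≡.trans (sym p) (z y) of λ () }
Span? (ψ ∷ ψs) φ with Span? ψs φ | Span? ψs (φ ⊕ ψ)
... | yes s | _     = yes (skip s)
... | no _  | yes t = yes (use t)
... | no ¬s | no ¬t = no λ { (skip s) → ¬s s ; (use t) → ¬t t }

-- Only `swap` has content: a relation expressing `ψ` with the help of `φ` also expresses `φ` with
-- the help of `ψ`.
Indep-resp-↭ : φs ↭ ψs → Indep φs → Indep ψs
Indep-resp-↭ refl         i             = i
Indep-resp-↭ (prep _ p)   (¬s , i)      = (λ s → ¬s (Span-resp-↭ (↭-sym p) s)) , Indep-resp-↭ p i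
Indep-resp-↭ (swap φ ψ p) (¬s , ¬t , i) =
  (λ { (skip s) → ¬t (Span-resp-↭ (↭-sym p) s)
     ; (use s)  → ¬s (use (Span-resp-↭ (↭-sym p) (Span-⊕-comm ψ φ s))) }) ,
  (λ s → ¬s (skip (Span-resp-↭ (↭-sym p) s))) ,
  Indep-resp-↭ p i
Indep-resp-↭ (trans p q)  i             = Indep-resp-↭ q (Indep-resp-↭ p i)

Indep-++⁻ʳ : ∀ (φs : List (Functional n)) → Indep (φs ++ ψs) → Indep ψs
Indep-++⁻ʳ []       i       = i
Indep-++⁻ʳ (_ ∷ φs) (_ , i) = Indep-++⁻ʳ φs i

-- The first of the φs (from the right) that needs ψ serves as the pivot π; adding
-- it to the others that need ψ brings them into the span of ψs.
eliminate : ∀ (φs : List (Functional n)) → Indep φs → All (Span (ψ ∷ ψs)) φs →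
  All (Span ψs) φs ⊎
  ∃₂ λ π φs′ → Span ψs (π ⊕ ψ) × Span φs π × All (Span φs) φs′ ×
               length φs ≡ suc (length φs′) × Indep φs′ × All (Span ψs) φs′
eliminate []       _        _        = inj₁ []
eliminate {ψ = ψ} (φ ∷ φs) (¬s , i) (t ∷ ts) with eliminate φs i ts | t
... | inj₁ ss | skip s = inj₁ (s ∷ ss)
... | inj₁ ss | use s  = inj₂
  ( φ , φs , s , All.head (Span-self (φ ∷ φs)) , All.map skip (Span-self φs) , refl , i , ss )
... | inj₂ (π , φs′ , pψ , pφ , sub , len , i′ , ss) | skip s = inj₂
  ( π , φ ∷ φs′ , pψ , skip pφ , All.head (Span-self (φ ∷ φs)) ∷ All.map skip sub
  , cong suc len , ((λ r → ¬s (Span-mono sub r)) , i′) , s ∷ ss )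
... | inj₂ (π , φs′ , pψ , pφ , sub , len , i′ , ss) | use s = inj₂
  ( π , (φ ⊕ π) ∷ φs′ , pψ , skip pφ
  , Span-⊕ (All.head (Span-self (φ ∷ φs))) (skip pφ) ∷ All.map skip sub
  , cong suc len , ((λ r → ¬s (Span-⊕⁻ʳ (Span-mono sub r) pφ)) , i′)
  , Span-⊕-trans φ ψ π s (Span-⊕-comm π ψ pψ) ∷ ss )

-- Induction on the spanning list: dropping its head either costs nothing or, after `eliminate`,
-- costs exactly one independent functional.
steinitz : ∀ (φs ψs : List (Functional n)) → Indep φs → All (Span ψs) φs → length φs ≤ length ψs
steinitz []       _        _        _           = z≤n
steinitz (_ ∷ _)  []       (¬s , _) (none z ∷ _) = ⊥-elim (¬s (Span-zero z))
steinitz φs@(_ ∷ _) (_ ∷ ψs) i ss with eliminate φs i ss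
... | inj₁ ts = ≤-trans (steinitz φs ψs i ts) (n≤1+n _)
... | inj₂ (_ , φs′ , _ , _ , _ , len , i′ , ts) =
  ≤-trans (≤-reflexive len) (s≤s (steinitz φs′ ψs i′ ts))

-- Solving independent linear systems.

-- By induction there are `z` for `φ` and `z′` for `φ ⊕ ψ`, both killing the remaining functionals.
-- If `ψ` vanishes at one of them, that one works; otherwise `φ z′` is false and the sum `z ⊞ z′`
-- works.
separate : All Linear ψs → Linear φ → ¬ Span ψs φ → ∃[ z ] φ z ≡ true × All (λ ψ → ψ z ≡ false) ψs
separate {φ = φ} [] lφ ¬s with search φ
... | inj₁ z       = ⊥-elim (¬s (none z))
... | inj₂ (z , p) = z , p , []
separate {ψs = ψ ∷ ψs} {φ = φ} (lψ ∷ ls) lφ ¬s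
  with separate ls lφ (¬s ∘ skip) | separate ls lφ⊕ψ (¬s ∘ use)
  where
  lφ⊕ψ : Linear (φ ⊕ ψ)
  lφ⊕ψ y z = ≡.trans (cong₂ _xor_ (lφ y z) (lψ y z))
    (xor-interchange (φ y) (φ z) (ψ y) (ψ z))
... | z , p , vs | z′ , p′ , vs′ with ψ z in q | ψ z′ in q′
... | false | _     = z , p , q ∷ vs
... | true  | false = z′ , ≡.trans (sym (xor-identityʳ _)) p′ , q′ ∷ vs′
... | true  | true  = z ⊞ z′ , ≡.trans (lφ z z′) (≡.trans (cong (_xor φ z′) p) φz′) ,
  ≡.trans (lψ z z′) (cong₂ _xor_ q q′) ∷ vanish ls vs vs′
  where
  φz′ : not (φ z′) ≡ true
  φz′ = ≡.trans (xor-comm true (φ z′)) p′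
  vanish : ∀ {χs} → All Linear χs → All (λ χ → χ z ≡ false) χs → All (λ χ → χ z′ ≡ false) χs →
           All (λ χ → χ (z ⊞ z′) ≡ false) χs
  vanish []       []       []       = []
  vanish (l ∷ ls) (v ∷ vs) (w ∷ ws) = ≡.trans (l z z′) (cong₂ _xor_ v w) ∷ vanish ls vs ws

-- A solution of the tail that misses the first equation is corrected by a vector from `separate`,
-- which flips the first functional and leaves the others alone.
solvable : (cs : List (Functional n × 𝔽₂)) → All (Linear ∘ proj₁) cs → Indep (map proj₁ cs) →
  ∃[ y ] All (λ c → proj₁ c y ≡ proj₂ c) cs
solvable {n} []         _        _        = replicate n false , []
solvable ((φ , b) ∷ cs) (l ∷ ls) (¬s , i) with solvable cs ls i
... | y , es with φ y ≟ b
... | yes p  = y , p ∷ es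
... | no  ¬p with separate (All.map⁺ ls) l ¬s
...   | z , q , vs =
  y ⊞ z , ≡.trans (l y z) (≡.trans (cong (φ y xor_) q) (flip ¬p)) ∷ shifted ls es (All.map⁻ vs)
  where
  flip : ∀ {a b} → a ≢ b → a xor true ≡ b
  flip {true}  {true}  ne = ⊥-elim (ne refl)
  flip {true}  {false} ne = refl
  flip {false} {true}  ne = refl
  flip {false} {false} ne = ⊥-elim (ne refl)
  shifted : ∀ {cs} → All (Linear ∘ proj₁) cs → All (λ c → proj₁ c y ≡ proj₂ c) cs →
            All (λ c → proj₁ c z ≡ false) cs → All (λ c → proj₁ c (y ⊞ z) ≡ proj₂ c) cs
  shifted []       []       []       = []
  shifted (l ∷ ls) (e ∷ es) (v ∷ vs) =
    ≡.trans (l y z) (≡.trans (cong₂ _xor_ e v) (xor-identityʳ _)) ∷ shifted ls es vs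

-- Extending independent lists.

record Extension (f : I → Functional n) (is : List I) (φs : List (Functional n)) : Set where
  field
    chosen rest : List I
    perm        : is ↭ chosen ++ rest
    indep       : Indep (map f chosen ++ φs)
    spans       : All (Span (map f chosen ++ φs)) (map f is)

-- Greedy from the right: an index is chosen exactly when its functional escapes the span built so
-- far.
extend : (f : I → Functional n) (is : List I) → Indep φs → Extension f is φs
extend f [] ind = record { chosen = [] ; rest = [] ; perm = refl ; indep = ind ; spans = [] }
extend {φs = φs} f (i ∷ is) ind with Span? (map f (Extension.chosen (extend f is ind)) ++ φs) (f i)
... | yes s = record
  { chosen = E.chosen ; rest = i ∷ E.rest
  ; perm = trans (prep i E.perm) (↭-sym (shift i E.chosen E.rest))
  ; indep = E.indep ; spans = s ∷ E.spans }
  where module E = Extension (extend f is ind)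
... | no ¬s = record
  { chosen = i ∷ E.chosen ; rest = E.rest ; perm = prep i E.perm
  ; indep = ¬s , E.indep ; spans = All.head (Span-self _) ∷ All.map skip E.spans }
  where module E = Extension (extend f is ind)

-- Exchanging independent functionals for disjoint pairs.

all-or-pick : ∀ {P : I → Set} → Decidable P → (is : List I) →
  All P is ⊎ ∃₂ λ i js → is ↭ i ∷ js × ¬ P i
all-or-pick P? [] = inj₁ []
all-or-pick P? (i ∷ is) with P? i | all-or-pick P? is
... | no ¬p | _                       = inj₂ (i , is , refl , ¬p)
... | yes p | inj₁ ps                 = inj₁ (p ∷ ps)
... | yes p | inj₂ (j , js , eq , ¬q) = inj₂ (j , i ∷ js , trans (prep i eq) (swap i j refl) , ¬q)

flatten : List (I × I) → List I
flatten []             = []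
flatten ((i , j) ∷ ps) = i ∷ j ∷ flatten ps

flatten⁺ : ∀ {ps qs : List (I × I)} → ps ↭ qs → flatten ps ↭ flatten qs
flatten⁺ refl                       = refl
flatten⁺ (prep (i , j) p)           = prep i (prep j (flatten⁺ p))
flatten⁺ (swap (i , j) (k , l) p)   =
  trans (shifts (i ∷ j ∷ []) (k ∷ l ∷ [])) (++⁺ˡ (k ∷ l ∷ i ∷ j ∷ []) (flatten⁺ p))
flatten⁺ (trans p q)                = trans (flatten⁺ p) (flatten⁺ q)

pairSum : (I → Functional n) → I × I → Functional n
pairSum f (i , j) = f i ⊕ f j

module Pairing (f : I → Functional n) (φs : List (Functional n)) where

  Q : List (I × I) → List (Functional n)
  Q ps = map (pairSum f) ps ++ φs

  Q-resp-↭ : ∀ {ps qs} → ps ↭ qs → Q ps ↭ Q qs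
  Q-resp-↭ p = ++⁺ʳ φs (map⁺ (pairSum f) p)

  -- Congruence of `f i` and `f j` modulo the pair sums and `φs`. Two unmatched indices can be added
  -- as a new independent pair exactly when they are not congruent.
  _~_[_] : I → I → List (I × I) → Set
  i ~ j [ ps ] = Span (Q ps) (f i ⊕ f j)

  ~-sym : ∀ {ps} i j → i ~ j [ ps ] → j ~ i [ ps ]
  ~-sym i j = Span-⊕-comm (f i) (f j)

  ~-trans : ∀ {ps} i j k → i ~ j [ ps ] → j ~ k [ ps ] → i ~ k [ ps ]
  ~-trans i j k = Span-⊕-trans (f i) (f j) (f k)

  partners : ∀ ps → All (λ (i , j) → i ~ j [ ps ]) ps
  partners ps = All.map⁻ (All.++⁻ˡ _ (Span-self (Q ps)))

  -- The span of Q ps has index at most two in that of Q (p ∷ ps).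
  pigeonhole : ∀ {p ps} i j k us → i ~ j [ p ∷ ps ] → i ~ k [ p ∷ ps ] →
    ∃₂ λ w w′ → ∃[ vs ] i ∷ j ∷ k ∷ us ↭ w ∷ w′ ∷ vs × w ~ w′ [ ps ]
  pigeonhole i j k us (skip s) _        = i , j , _ , refl , s
  pigeonhole i j k us (use _)  (skip t) = i , k , _ , prep i (swap j k refl) , t
  pigeonhole {p} i j k us (use s) (use t) = j , k , _ , shifts (i ∷ []) (j ∷ k ∷ []) ,
    Span-resp-≗ (λ y → ≡.trans (xor-cancel-common (f i y xor f j y) (f i y xor f k y) (pairSum f p y))
      (≡.trans (cong (_xor (f i y xor f k y)) (xor-comm (f i y) (f j y)))
        (xor-telescope (f j y) (f i y) (f k y))))
      (Span-⊕ s t)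

  flatten-~ : ∀ {t qs} ps → All (λ (i , j) → i ~ j [ qs ]) ps → All (λ (i , j) → i ~ t [ qs ]) ps →
    All (λ i → i ~ t [ qs ]) (flatten ps)
  flatten-~ []             []       []       = []
  flatten-~ {t} ((i , j) ∷ ps) (e ∷ es) (h ∷ hs) =
    h ∷ ~-trans j i t (~-sym i j e) h ∷ flatten-~ ps es hs

  -- If all unmatched indices are congruent to t but a pair (a , b) is not, choose
  -- unmatched w, w′ congruent modulo the remaining pairs: (a , b) may be replaced by
  -- (a , w) and (b , w′).  If everything is congruent to t, then f t and Q ps span.
  step : ∀ as bs {is} → is ↭ as ++ bs → Indep (map f as ++ φs) →
    ∀ {ps w₁ w₂ w₃ us} → is ↭ flatten ps ++ w₁ ∷ w₂ ∷ w₃ ∷ us → Indep (Q ps) →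
    length as ≤ suc (length ps) ⊎
    ∃₂ λ qs vs → length (w₁ ∷ w₂ ∷ w₃ ∷ us) ≡ suc (suc (length vs)) ×
                 is ↭ flatten qs ++ vs × Indep (Q qs)
  step as bs {is} is↭ ind {ps} {t} {w₂} {w₃} {us} m iQ
    with all-or-pick (λ i → Span? (Q ps) (f i ⊕ f t)) (w₂ ∷ w₃ ∷ us)
  ... | inj₂ (w , vs , eq , ¬w~t) = inj₂
    ( (t , w) ∷ ps , vs , cong suc (↭-length eq)
    , trans m (trans (++⁺ˡ (flatten ps) (prep t eq)) (shifts (flatten ps) (t ∷ w ∷ [])))
    , (¬w~t ∘ ~-sym t w) , iQ )
  ... | inj₁ us~t@(w₂~t ∷ w₃~t ∷ _) with all-or-pick (λ (i , j) → Span? (Q ps) (f i ⊕ f t)) ps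
  ... | inj₁ ps~t = inj₁ (+-cancelʳ-≤ (length φs) _ _ (begin
    length as + length φs
      ≡⟨ cong (_+ length φs) (length-map f as) ⟨
    length (map f as) + length φs
      ≡⟨ length-++ (map f as) ⟨
    length (map f as ++ φs)
      ≤⟨ steinitz _ (f t ∷ Q ps) ind spanned ⟩
    suc (length (Q ps))
      ≡⟨ cong suc (length-++ (map (pairSum f) ps)) ⟩
    suc (length (map (pairSum f) ps) + length φs)
      ≡⟨ cong (λ k → suc (k + length φs)) (length-map (pairSum f) ps) ⟩
    suc (length ps) + length φs
      ∎))
    where
    open ≤-Reasoning
    is~t : All (λ i → i ~ t [ ps ]) is
    is~t = All-resp-↭ (↭-sym m) (All.++⁺ (flatten-~ ps (partners ps) ps~t)
      (Span-zero (λ y → xor-same (f t y)) ∷ us~t))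
    spanned : All (Span (f t ∷ Q ps)) (map f as ++ φs)
    spanned = All.++⁺ (All.map⁺ (All.map use (All.++⁻ˡ as (All-resp-↭ is↭ is~t))))
      (All.map skip (All.++⁻ʳ (map (pairSum f) ps) (Span-self (Q ps))))
  ... | inj₂ ((a , b) , ps′ , eq , ¬a~t)
    with pigeonhole {a , b} {ps′} t w₂ w₃ us (to′ (~-sym w₂ t w₂~t)) (to′ (~-sym w₃ t w₃~t))
    where
    to′ : ∀ {φ} → Span (Q ps) φ → Span (Q ((a , b) ∷ ps′)) φ
    to′ = Span-resp-↭ (Q-resp-↭ eq)
  ... | w , w′ , vs , eq′ , w~w′ = inj₂
    ( (a , w) ∷ (b , w′) ∷ ps′ , vs , ↭-length eq′
    , trans m (trans (++⁺ (flatten⁺ eq) eq′)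
        (prep a (trans (prep b (shifts (flatten ps′) (w ∷ w′ ∷ []))) (swap b w refl))))
    -- A dependence not using `(b , w′)` would make `a` congruent to `w`, hence to `t`. One using
    -- it, added to the congruence of `w` and `w′`, would give one of `a` and `b` modulo the
    -- remaining pairs, against `iQ′`.
    , ( λ { (skip s) → ¬a~t (~-trans a w t (from′ s) w~t)
          ; (use s)  → proj₁ iQ′ (Span-resp-≗
              (λ y → identity (f a y) (f b y) (f w y) (f w′ y)) (Span-⊕ s w~w′)) })
    , ( λ s → ¬a~t (~-trans a b t a~b (~-trans b w′ t (from′ s) w′~t)) )
    , proj₂ iQ′ )
    where
    from′ : ∀ {φ} → Span (Q ps′) φ → Span (Q ps) φ
    from′ = Span-resp-↭ (Q-resp-↭ (↭-sym eq)) ∘ skip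
    iQ′ : Indep (Q ((a , b) ∷ ps′))
    iQ′ = Indep-resp-↭ (Q-resp-↭ eq) iQ
    a~b : a ~ b [ ps ]
    a~b = All.head (All-resp-↭ eq (partners ps))
    ws~t : All (λ i → i ~ t [ ps ]) (w ∷ w′ ∷ vs)
    ws~t = All-resp-↭ eq′ (Span-zero (λ y → xor-same (f t y)) ∷ us~t)
    w~t  = All.head ws~t
    w′~t = All.head (All.tail ws~t)
    identity : ∀ a b w w′ → ((a xor w) xor (b xor w′)) xor (w xor w′) ≡ a xor b
    identity a b w w′ = ≡.trans (cong (_xor (w xor w′)) (xor-interchange a w b w′))
      (xor-cancelʳ (a xor b) (w xor w′))

  -- One pair is lost in the first alternative of `large` because the spanning list in `step`
  -- contains `f t` besides the pair sums. The 2 in the second arises because the pigeonhole needs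
  -- three unmatched indices.
  record LargeMatching (k : ℕ) (is : List I) : Set where
    field
      pairs     : List (I × I)
      unmatched : List I
      perm      : is ↭ flatten pairs ++ unmatched
      indep     : Indep (Q pairs)
      large     : k ≤ suc (length pairs) ⊎ length unmatched ≤ 2

  pairing : ∀ as bs {is} → is ↭ as ++ bs → Indep (map f as ++ φs) → LargeMatching (length as) is
  pairing as bs {is} is↭ ind = go (length is) [] is ≤-refl refl (Indep-++⁻ʳ (map f as) ind)
    where
    -- `k` bounds the number of unmatched indices and serves as fuel; each successful `step` uses up
    -- two of them.
    go : ∀ k ps us → length us ≤ k → is ↭ flatten ps ++ us → Indep (Q ps) →
      LargeMatching (length as) is
    go k ps us@[] _ m i =
      record { pairs = ps ; unmatched = us ; perm = m ; indep = i ; large = inj₂ z≤n }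
    go k ps us@(_ ∷ []) _ m i =
      record { pairs = ps ; unmatched = us ; perm = m ; indep = i ; large = inj₂ (s≤s z≤n) }
    go k ps us@(_ ∷ _ ∷ []) _ m i =
      record { pairs = ps ; unmatched = us ; perm = m ; indep = i ; large = inj₂ ≤-refl }
    go (suc k) ps us@(_ ∷ _ ∷ _ ∷ _) (s≤s le) m i with step as bs is↭ ind m i
    ... | inj₁ small =
      record { pairs = ps ; unmatched = us ; perm = m ; indep = i ; large = inj₁ small }
    ... | inj₂ (qs , vs , len , m′ , i′) =
      go k qs vs (≤-trans (n≤1+n _) (≤-trans (≤-reflexive (sym (suc-injective len))) le)) m′ i′

-- Selecting conditions from two bases.

++-interchange : (as bs cs ds : List I) → (as ++ bs) ++ (cs ++ ds) ↭ (as ++ cs) ++ (bs ++ ds)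
++-interchange {I} = CommutativeSemigroup.interchange
  (CommutativeMonoid.commutativeSemigroup (++-commutativeMonoid {A = I}))

split : (p : I → Bool) (is : List I) →
  ∃₂ λ js ks → is ↭ js ++ ks × All (λ i → p i ≡ false) js × All (λ i → p i ≡ true) ks
split p [] = [] , [] , refl , [] , []
split p (i ∷ is) with split p is | p i in eq
... | js , ks , perm , fs , ts | false = i ∷ js , ks , prep i perm , eq ∷ fs , ts
... | js , ks , perm , fs , ts | true  =
  js , i ∷ ks , trans (prep i perm) (↭-sym (shift i js ks)) , fs , eq ∷ ts

-- `js` is the smaller half: choosing it never exceeds half of the list, as `C-small` requires, and
-- rounding loses at most one.
halve : (is : List I) →
  ∃₂ λ js ks → is ↭ js ++ ks × length js ≤ length ks × length ks ≤ suc (length js)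
halve []           = [] , [] , refl , z≤n , z≤n
halve (i ∷ [])     = [] , i ∷ [] , refl , z≤n , s≤s z≤n
halve (i ∷ j ∷ is) with halve is
... | js , ks , perm , l , l′ =
  i ∷ js , j ∷ ks , prep i (trans (prep j perm) (↭-sym (shift j js ks))) , s≤s l , s≤s l′

length-flatten : (ps : List (I × I)) → length (flatten ps) ≡ 2 * length ps
length-flatten []       = refl
length-flatten (p ∷ ps) = ≡.trans (cong (λ k → suc (suc k)) (length-flatten ps)) (sym (*-suc 2 (length ps)))

All-flatten⁻ : ∀ {P : I → Set} ps → All P (flatten ps) → All (λ (i , j) → P i × P j) ps
All-flatten⁻ []       []             = []
All-flatten⁻ (p ∷ ps) (pi ∷ pj ∷ as) = (pi , pj) ∷ All-flatten⁻ ps as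

-- `p i` will be the value of the i-th functional at `u`. Each single and each pair will force one
-- disagreement with the centre, so `large` yields distance at least n/2 - 3.
record Selection (p : I → Bool) (is : List I) : Set where
  field
    singles     : List I
    pairs       : List (I × I)
    rest        : List I
    perm        : is ↭ singles ++ flatten pairs ++ rest
    singles-off : All (λ i → p i ≡ false) singles
    pairs-on    : All (λ (i , j) → p i ≡ true × p j ≡ true) pairs
    large       : length is ≤ 6 + 2 * (length singles + length pairs)

-- `a` and `a₁` are the sizes of `E₀` and `E₁`. If the exchange of `A₁` loses at most one, doubling
-- `N ≤ A₁ + (A₀ + C)` and cancelling `2 * C ≤ N` suffices. If instead `E₁` is paired up almost
-- entirely, only `a ≤ 2 * A₀ + 2` is missing; it follows since half of `X` together with all of
-- `E₀` has size at most `A₀ + C`, whereas `X` and `E₀` together reach `N`.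
large-by-dimension : ∀ {N X a a₁ cx C A₀ A₁ P} → N ≤ X + a → X ≤ 2 + 2 * cx → cx + a ≤ A₀ + C →
  2 * C ≤ N → N ≤ A₁ + (A₀ + C) → N ≡ a + a₁ → A₁ ≤ suc P ⊎ a₁ ≤ 2 * P + 2 →
  N ≤ 6 + 2 * (A₀ + P)
large-by-dimension {N} {X} {a} {a₁} {cx} {C} {A₀} {A₁} {P} _ _ _ hC hN _ (inj₁ hP) =
  +-cancelʳ-≤ N _ _ (begin
    N + N                            ≤⟨ +-mono-≤ hN hN ⟩
    (A₁ + (A₀ + C)) + (A₁ + (A₀ + C)) ≡⟨ identity₁ A₁ A₀ C ⟩
    2 * A₁ + 2 * A₀ + 2 * C          ≤⟨ +-mono-≤ (+-monoˡ-≤ (2 * A₀) (*-monoʳ-≤ 2 hP)) hC ⟩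
    2 * suc P + 2 * A₀ + N           ≡⟨ identity₂ P A₀ N ⟩
    2 + 2 * (A₀ + P) + N             ≤⟨ +-monoˡ-≤ N (m≤n+m (2 + 2 * (A₀ + P)) 4) ⟩
    6 + 2 * (A₀ + P) + N             ∎)
  where
  open ≤-Reasoning
  identity₁ : ∀ x y z → (x + (y + z)) + (x + (y + z)) ≡ 2 * x + 2 * y + 2 * z
  identity₁ = solve-∀
  identity₂ : ∀ x y z → 2 * suc x + 2 * y + z ≡ 2 + 2 * (y + x) + z
  identity₂ = solve-∀
large-by-dimension {N} {X} {a} {a₁} {cx} {C} {A₀} {A₁} {P} hX hcx hA hC _ hN (inj₂ hP) = begin
  N                              ≡⟨ hN ⟩
  a + a₁                         ≤⟨ +-mono-≤ a≤ hP ⟩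
  (2 * A₀ + 2) + (2 * P + 2)     ≡⟨ identity₃ A₀ P ⟩
  4 + 2 * (A₀ + P)               ≤⟨ m≤n+m (4 + 2 * (A₀ + P)) 2 ⟩
  6 + 2 * (A₀ + P)               ∎
  where
  open ≤-Reasoning
  identity₃ : ∀ x y → (2 * x + 2) + (2 * y + 2) ≡ 4 + 2 * (x + y)
  identity₃ = solve-∀
  identity₄ : ∀ x y → y + ((2 + 2 * x) + y) ≡ 2 * (x + y) + 2
  identity₄ = solve-∀
  identity₅ : ∀ x y → 2 * (x + y) + 2 ≡ (2 * x + 2) + 2 * y
  identity₅ = solve-∀
  a≤ : a ≤ 2 * A₀ + 2
  a≤ = +-cancelʳ-≤ N _ _ (begin
    a + N                  ≤⟨ +-monoʳ-≤ a hX ⟩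
    a + (X + a)            ≤⟨ +-monoʳ-≤ a (+-monoˡ-≤ a hcx) ⟩
    a + ((2 + 2 * cx) + a) ≡⟨ identity₄ cx a ⟩
    2 * (cx + a) + 2       ≤⟨ +-monoˡ-≤ 2 (*-monoʳ-≤ 2 hA) ⟩
    2 * (A₀ + C) + 2       ≡⟨ identity₅ A₀ C ⟩
    (2 * A₀ + 2) + 2 * C   ≤⟨ +-monoʳ-≤ (2 * A₀ + 2) hC ⟩
    (2 * A₀ + 2) + N       ∎)

-- The constant 6 originates here: halving costs 2 for the indices off and 2 for those on, and the
-- pair lost in the exchange costs 2 more.
large-by-halves : ∀ {N b b₁ C₀ C₁ P} → N ≡ b + b₁ → b ≤ 2 + 2 * C₀ → b₁ ≤ 2 + 2 * C₁ →
  C₁ ≤ suc P ⊎ b₁ ≤ 2 * P + 2 → N ≤ 6 + 2 * (C₀ + P)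
large-by-halves {N} {b} {b₁} {C₀} {C₁} {P} hN hb hb₁ hP = begin
  N                            ≡⟨ hN ⟩
  b + b₁                       ≤⟨ +-mono-≤ hb (bound hP) ⟩
  (2 + 2 * C₀) + (2 * P + 4)   ≡⟨ identity₁ C₀ P ⟩
  6 + 2 * (C₀ + P)             ∎
  where
  open ≤-Reasoning
  identity₁ : ∀ x y → (2 + 2 * x) + (2 * y + 4) ≡ 6 + 2 * (x + y)
  identity₁ = solve-∀
  identity₂ : ∀ x → 2 + 2 * suc x ≡ 2 * x + 4
  identity₂ = solve-∀
  bound : C₁ ≤ suc P ⊎ b₁ ≤ 2 * P + 2 → b₁ ≤ 2 * P + 4
  bound (inj₁ h) = ≤-trans hb₁ (≤-trans (+-monoʳ-≤ 2 (*-monoʳ-≤ 2 h)) (≤-reflexive (identity₂ P)))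
  bound (inj₂ h) = ≤-trans h (+-monoʳ-≤ (2 * P) (s≤s (s≤s z≤n)))

record Halves (q : I → Bool) (is : List I) : Set where
  field
    off off′ on on′ : List I
    perm     : is ↭ (off ++ off′) ++ (on ++ on′)
    q-off    : All (λ i → q i ≡ false) off
    q-on     : All (λ i → q i ≡ true) (on ++ on′)
    off≤off′ : length off ≤ length off′
    off′≤off : length off′ ≤ suc (length off)
    on≤on′   : length on ≤ length on′
    on′≤on   : length on′ ≤ suc (length on)

halves : (q : I → Bool) (is : List I) → Halves q is
halves q is =
  let js , ks , perm , fs , ts = split q is
      as , as′ , permj , l₁ , l₂ = halve js
      bs , bs′ , permk , l₃ , l₄ = halve ks
  in record
    { off = as ; off′ = as′ ; on = bs ; on′ = bs′
    ; perm = trans perm (++⁺ permj permk)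
    ; q-off = All.++⁻ˡ as (All-resp-↭ permj fs)
    ; q-on = All-resp-↭ permk ts
    ; off≤off′ = l₁ ; off′≤off = l₂ ; on≤on′ = l₃ ; on′≤on = l₄ }

length-++₂ : (as bs cs ds : List I) →
  length ((as ++ bs) ++ (cs ++ ds)) ≡ (length as + length bs) + (length cs + length ds)
length-++₂ as bs cs ds = ≡.trans (length-++ (as ++ bs)) (cong₂ _+_ (length-++ as) (length-++ cs))

double-≤ : ∀ {a a′ b b′ c c′ d d′} → a ≤ a′ → b ≤ b′ → c ≤ c′ → d ≤ d′ →
  2 * ((a + b) + (c + d)) ≤ ((a + a′) + (b + b′)) + ((c + c′) + (d + d′))
double-≤ {a} {a′} {b} {b′} {c} {c′} {d} {d′} ha hb hc hd = ≤-trans (≤-reflexive (identity a b c d))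
  (+-mono-≤ (+-mono-≤ (+-monoʳ-≤ a ha) (+-monoʳ-≤ b hb)) (+-mono-≤ (+-monoʳ-≤ c hc) (+-monoʳ-≤ d hd)))
  where
  identity : ∀ a b c d → 2 * ((a + b) + (c + d)) ≡ ((a + a) + (b + b)) + ((c + c) + (d + d))
  identity = solve-∀

≤-double : ∀ {a a′ b b′} → a′ ≤ suc a → b′ ≤ suc b → (a + a′) + (b + b′) ≤ 2 + 2 * (a + b)
≤-double {a} {a′} {b} {b′} ha hb = ≤-trans (+-mono-≤ (+-monoʳ-≤ a ha) (+-monoʳ-≤ b hb))
  (≤-reflexive (identity a b))
  where
  identity : ∀ a b → (a + suc a) + (b + suc b) ≡ 2 + 2 * (a + b)
  identity = solve-∀

-- `e` and `v` stand for the coordinate functionals of the two inverse maps, `p` and `q` for their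
-- values at `u`. Joint independence lets one linear system impose all conditions.
select : (e v : I → Functional n) (p q : I → Bool) (is : List I) →
  Indep (map e is) → Indep (map v is) →
  ∃₂ λ (S : Selection p is) (T : Selection q is) → let open Selection in
    Indep (map (pairSum v) (pairs T) ++ map (pairSum e) (pairs S) ++
           map e (singles S) ++ map v (singles T))
select {I} {n} e v p q is ind-e ind-v
  with split p is
... | E₀ , E₁ , is↭E , E₀-off , E₁-on = S , T , P′.indep
  where
  open ≤-Reasoning

  ind-E₀ : Indep (map e E₀)
  ind-E₀ = Indep-++⁻ʳ (map e E₁) (Indep-resp-↭
    (trans (map⁺ e (trans is↭E (++-comm E₀ E₁))) (↭-reflexive (map-++ e E₁ E₀))) ind-e)

  open Extension (extend v is ind-E₀) using ()
    renaming (chosen to X; rest to R; perm to is↭XR; indep to ind-X; spans to span-X)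
  module X = Halves (halves q X)
  module R = Halves (halves q R)

  -- `C` takes the smaller half of each of the four parts. Halving `X` separately keeps half of a
  -- complement of `E₀` inside `C`, for `A₀-large`; splitting by `q` gives `T` half of the indices
  -- off and half of those on.
  CX CR C C₀ C₁ C₁′ V₁ : List I
  CX  = X.off ++ X.on
  CR  = R.off ++ R.on
  C   = CX ++ CR
  C₀  = X.off ++ R.off
  C₁  = X.on ++ R.on
  C₁′ = X.on′ ++ R.on′
  V₁  = (X.on ++ X.on′) ++ (R.on ++ R.on′)

  X↭ : X ↭ (X.off′ ++ X.on′) ++ CX
  X↭ = trans X.perm (trans (++-interchange X.off X.off′ X.on X.on′) (++-comm CX _))
  R↭ : R ↭ (R.off′ ++ R.on′) ++ CR
  R↭ = trans R.perm (trans (++-interchange R.off R.off′ R.on R.on′) (++-comm CR _))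

  is↭V : is ↭ (C₀ ++ (X.off′ ++ R.off′)) ++ V₁
  is↭V = trans is↭XR (trans (++⁺ X.perm R.perm) (trans
    (++-interchange (X.off ++ X.off′) (X.on ++ X.on′) (R.off ++ R.off′) (R.on ++ R.on′))
    (++⁺ʳ V₁ (++-interchange X.off X.off′ R.off R.off′))))

  ind-C : Indep (map v C)
  ind-C = Indep-++⁻ʳ (map v D) (Indep-resp-↭ (trans (map⁺ v is↭DC) (↭-reflexive (map-++ v D C))) ind-v)
    where
    D : List I
    D = (X.off′ ++ X.on′) ++ (R.off′ ++ R.on′)
    is↭DC : is ↭ D ++ C
    is↭DC = trans is↭XR (trans (++⁺ X↭ R↭) (++-interchange (X.off′ ++ X.on′) CX (R.off′ ++ R.on′) CR))

  ind-CX : Indep (map v CX ++ map e E₀)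
  ind-CX = Indep-++⁻ʳ (map v D) (Indep-resp-↭
    (trans (++⁺ʳ (map e E₀) (trans (map⁺ v X↭) (↭-reflexive (map-++ v D CX))))
      (↭-reflexive (++-assoc (map v D) (map v CX) (map e E₀)))) ind-X)
    where
    D : List I
    D = X.off′ ++ X.on′

  -- The order matters: with `E₀` treated first, `A₀` and `C` alone span `E₀`, which is what
  -- `A₀-large` counts. Adding `A₁` then spans all of `e`.
  open Extension (extend e E₀ ind-C) using ()
    renaming (chosen to A₀; rest to A₀′; perm to E₀↭; indep to ind₀; spans to span₀)
  open Extension (extend e E₁ ind₀) using ()
    renaming (chosen to A₁; rest to A₁′; perm to E₁↭; indep to ind₁; spans to span₁)

  len-AC : length (map e A₀ ++ map v C) ≡ length A₀ + length C
  len-AC = ≡.trans (length-++ (map e A₀)) (cong₂ _+_ (length-map e A₀) (length-map v C))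

  X-large : length is ≤ length X + length E₀
  X-large = begin
    length is                      ≡⟨ length-map v is ⟨
    length (map v is)              ≤⟨ steinitz _ _ ind-v span-X ⟩
    length (map v X ++ map e E₀)   ≡⟨ length-++ (map v X) ⟩
    length (map v X) + length (map e E₀) ≡⟨ cong₂ _+_ (length-map v X) (length-map e E₀) ⟩
    length X + length E₀           ∎

  A₀-large : length CX + length E₀ ≤ length A₀ + length C
  A₀-large = begin
    length CX + length E₀ ≡⟨ cong₂ _+_ (length-map v CX) (length-map e E₀) ⟨
    length (map v CX) + length (map e E₀) ≡⟨ length-++ (map v CX) ⟨
    length (map v CX ++ map e E₀) ≤⟨ steinitz _ _ ind-CX (All.++⁺ CX-spanned span₀) ⟩
    length (map e A₀ ++ map v C)  ≡⟨ len-AC ⟩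
    length A₀ + length C          ∎
    where
    CX-spanned : All (Span (map e A₀ ++ map v C)) (map v CX)
    CX-spanned = All.map (Span-++ʳ (map e A₀))
      (All.++⁻ˡ (map v CX) (subst (All (Span (map v C))) (map-++ v CX CR) (Span-self (map v C))))

  A₁-large : length is ≤ length A₁ + (length A₀ + length C)
  A₁-large = begin
    length is          ≡⟨ length-map e is ⟨
    length (map e is)  ≤⟨ steinitz _ _ ind-e (All-resp-↭ (↭-sym (map⁺ e is↭E))
      (subst (All _) (sym (map-++ e E₀ E₁)) (All.++⁺ (All.map (Span-++ʳ (map e A₁)) span₀) span₁))) ⟩
    length (map e A₁ ++ map e A₀ ++ map v C) ≡⟨ length-++ (map e A₁) ⟩
    length (map e A₁) + length (map e A₀ ++ map v C) ≡⟨ cong₂ _+_ (length-map e A₁) len-AC ⟩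
    length A₁ + (length A₀ + length C) ∎

  X-halved : length X ≤ 2 + 2 * length CX
  X-halved = begin
    length X ≡⟨ ≡.trans (↭-length X.perm) (length-++₂ X.off X.off′ X.on X.on′) ⟩
    _        ≤⟨ ≤-double X.off′≤off X.on′≤on ⟩
    2 + 2 * (length X.off + length X.on) ≡⟨ cong (λ k → 2 + 2 * k) (length-++ X.off) ⟨
    2 + 2 * length CX ∎

  C-small : 2 * length C ≤ length is
  C-small = begin
    2 * length C ≡⟨ cong (2 *_) (length-++₂ X.off X.on R.off R.on) ⟩
    _            ≤⟨ double-≤ X.off≤off′ X.on≤on′ R.off≤off′ R.on≤on′ ⟩
    _            ≡⟨ cong₂ _+_ (≡.trans (↭-length X.perm) (length-++₂ X.off X.off′ X.on X.on′))
                              (≡.trans (↭-length R.perm) (length-++₂ R.off R.off′ R.on R.on′)) ⟨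
    length X + length R ≡⟨ ≡.trans (↭-length is↭XR) (length-++ X) ⟨
    length is    ∎

  module P = Pairing.LargeMatching (Pairing.pairing e (map e A₀ ++ map v C) A₁ A₁′ E₁↭ ind₁)

  F = map (pairSum e) P.pairs ++ map e A₀ ++ map v C₀

  ind-C₁ : Indep (map v C₁ ++ F)
  ind-C₁ = Indep-resp-↭ (trans
    (++⁺ˡ (map (pairSum e) P.pairs) (trans (++⁺ˡ (map e A₀) C↭) (shifts (map e A₀) (map v C₁))))
    (shifts (map (pairSum e) P.pairs) (map v C₁))) P.indep
    where
    C↭ : map v C ↭ map v C₁ ++ map v C₀
    C↭ = trans (map⁺ v (trans (++-interchange X.off X.on R.off R.on) (++-comm C₀ C₁)))
               (↭-reflexive (map-++ v C₁ C₀))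

  V₁↭ : V₁ ↭ C₁ ++ C₁′
  V₁↭ = ++-interchange X.on X.on′ R.on R.on′

  -- The second exchange, of `C₁` for pairs within `V₁`, is carried out modulo `F`, which contains
  -- the pair sums of the first; so all selected functionals end up jointly independent.
  module P′ = Pairing.LargeMatching (Pairing.pairing v F C₁ C₁′ V₁↭ ind-C₁)

  unmatched : ∀ {k js us} (ps : List (I × I)) → js ↭ flatten ps ++ us →
    k ≤ suc (length ps) ⊎ length us ≤ 2 → k ≤ suc (length ps) ⊎ length js ≤ 2 * length ps + 2
  unmatched ps _    (inj₁ h) = inj₁ h
  unmatched {us = us} ps perm (inj₂ h) = inj₂ (≤-trans
    (≤-reflexive (≡.trans (↭-length perm)
      (≡.trans (length-++ (flatten ps)) (cong (_+ length us) (length-flatten ps)))))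
    (+-monoʳ-≤ (2 * length ps) h))

  regroup : ∀ {js ks} (as as′ : List I) (ps : List (I × I)) us → js ↭ as ++ as′ → ks ↭ flatten ps ++ us →
    js ++ ks ↭ as ++ flatten ps ++ (as′ ++ us)
  regroup as as′ ps us j k = trans (++⁺ j k)
    (trans (↭-reflexive (++-assoc as as′ _)) (++⁺ˡ as (shifts as′ (flatten ps))))

  S : Selection p is
  S = record
    { singles = A₀ ; pairs = P.pairs ; rest = A₀′ ++ P.unmatched
    ; perm = trans is↭E (regroup A₀ A₀′ P.pairs P.unmatched E₀↭ P.perm)
    ; singles-off = All.++⁻ˡ A₀ (All-resp-↭ E₀↭ E₀-off)
    ; pairs-on = All-flatten⁻ P.pairs (All.++⁻ˡ (flatten P.pairs) (All-resp-↭ P.perm E₁-on))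
    ; large = large-by-dimension {cx = length CX} {C = length C} {A₀ = length A₀} {A₁ = length A₁}
        X-large X-halved A₀-large C-small A₁-large
        (≡.trans (↭-length is↭E) (length-++ E₀)) (unmatched P.pairs P.perm P.large)
    }

  T : Selection q is
  T = record
    { singles = C₀ ; pairs = P′.pairs ; rest = (X.off′ ++ R.off′) ++ P′.unmatched
    ; perm = trans is↭V (regroup C₀ (X.off′ ++ R.off′) P′.pairs P′.unmatched refl P′.perm)
    ; singles-off = All.++⁺ X.q-off R.q-off
    ; pairs-on = All-flatten⁻ P′.pairs
        (All.++⁻ˡ (flatten P′.pairs) (All-resp-↭ P′.perm (All.++⁺ X.q-on R.q-on)))
    ; large = large-by-halves {C₀ = length C₀} {C₁ = length C₁}
        (≡.trans (↭-length is↭V) (length-++ (C₀ ++ (X.off′ ++ R.off′))))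
        (halved X.off X.off′ R.off R.off′ X.off′≤off R.off′≤off (++-interchange X.off R.off X.off′ R.off′))
        (halved X.on X.on′ R.on R.on′ X.on′≤on R.on′≤on refl)
        (unmatched P′.pairs P′.perm P′.large)
    }
    where
    halved : ∀ {js} (as as′ bs bs′ : List I) → length as′ ≤ suc (length as) → length bs′ ≤ suc (length bs) →
      js ↭ (as ++ as′) ++ (bs ++ bs′) → length js ≤ 2 + 2 * length (as ++ bs)
    halved as as′ bs bs′ la lb perm = ≤-trans
      (≤-reflexive (≡.trans (↭-length perm) (length-++₂ as as′ bs bs′)))
      (≤-trans (≤-double la lb) (≤-reflexive (cong (λ k → 2 + 2 * k) (sym (length-++ as)))))

-- Hamming distance as a count over index lists.

bit : Bool → ℕ
bit b = if b then 1 else 0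

-- Counting over lists lets the count be moved along the permutation stored in a `Selection`.
tally : (I → Bool) → List I → ℕ
tally g []       = 0
tally g (i ∷ is) = bit (g i) + tally g is

tally-cong : ∀ {g h : I → Bool} → g ≗ h → tally g ≗ tally h
tally-cong eq []       = refl
tally-cong eq (i ∷ is) = cong₂ _+_ (cong bit (eq i)) (tally-cong eq is)

tally-↭ : ∀ {is js} (g : I → Bool) → is ↭ js → tally g is ≡ tally g js
tally-↭ g refl                    = refl
tally-↭ g (prep i p)              = cong (λ k → bit (g i) + k) (tally-↭ g p)
tally-↭ g (swap {xs} {ys} i j p)  = ≡.trans (cong (λ k → bit (g i) + (bit (g j) + k)) (tally-↭ g p))
  (exchange (bit (g i)) (bit (g j)) (tally g ys))
  where
  exchange : ∀ a b c → a + (b + c) ≡ b + (a + c)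
  exchange = solve-∀
tally-↭ g (trans p q)             = ≡.trans (tally-↭ g p) (tally-↭ g q)

tally-not : (g : I → Bool) (is : List I) → tally g is + tally (not ∘ g) is ≡ length is
tally-not g []       = refl
tally-not g (i ∷ is) with g i
... | true  = cong suc (tally-not g is)
... | false = ≡.trans (+-suc _ _) (cong suc (tally-not g is))

-- A single contributes one, a pair exactly one, and the remaining indices can only add to the
-- count.
tally-selection : ∀ {p : I → Bool} {is} (S : Selection p is) (g : I → Bool) → let open Selection S in
  All (λ i → g i ≡ true) singles → All (λ (i , j) → g i xor g j ≡ true) pairs →
  length is ≤ 6 + 2 * tally g is
tally-selection {I} {is = is} S g hs hp = ≤-trans S.large (+-monoʳ-≤ 6 (*-monoʳ-≤ 2
  (≤-trans (count-singles S.singles hs) (≤-reflexive (sym (tally-↭ g S.perm))))))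
  where
  module S = Selection S
  count-pairs : ∀ ps → All (λ (i , j) → g i xor g j ≡ true) ps → length ps ≤ tally g (flatten ps ++ S.rest)
  count-pairs []             []       = z≤n
  count-pairs ((i , j) ∷ ps) (h ∷ hs) with g i | g j
  ... | true  | false = s≤s (count-pairs ps hs)
  ... | false | true  = s≤s (count-pairs ps hs)
  count-singles : ∀ is → All (λ i → g i ≡ true) is →
    length is + length S.pairs ≤ tally g (is ++ flatten S.pairs ++ S.rest)
  count-singles []       []       = count-pairs S.pairs hp
  count-singles (i ∷ is) (h ∷ hs) rewrite h = s≤s (count-singles is hs)

d≡tally : (x z : 𝔽₂^ n) → d x z ≡ tally (λ i → lookup x i xor lookup z i) (allFin n)
d≡tally {n} x z = go id
  where
  -- Generalising the identity to an arbitrary `h` lets the induction descend through both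
  -- tabulations.
  go : ∀ {m} (h : Fin m → Fin n) → Vec.count (λ i → ¬? (lookup x i ≟ lookup z i)) (Vec.tabulate h) ≡
    tally (λ i → lookup x i xor lookup z i) (tabulate h)
  go {zero}  h = refl
  go {suc m} h with lookup x (h zero) | lookup z (h zero)
  ... | true  | true  = go (h ∘ suc)
  ... | true  | false = cong suc (go (h ∘ suc))
  ... | false | true  = cong suc (go (h ∘ suc))
  ... | false | false = go (h ∘ suc)

-- Coordinate functionals of an inverse map.

record LinearInverse (L : 𝔽₂^ n → 𝔽₂^ n) : Set where
  field
    inv   : 𝔽₂^ n → 𝔽₂^ n
    left  : ∀ x → inv (L x) ≡ x
    right : ∀ y → L (inv y) ≡ y
    homo  : ∀ y z → inv (y ⊞ z) ≡ inv y ⊞ inv z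

  coord : Fin n → Functional n
  coord i y = lookup (inv y) i

  coord-linear : ∀ i → Linear (coord i)
  coord-linear i y z = ≡.trans (cong (λ w → lookup w i) (homo y z)) (lookup-zipWith _xor_ i (inv y) (inv z))

  -- The image under `L` of the i-th unit vector is a dual vector: the i-th coordinate functional is
  -- 1 there and all others vanish, hence so does their span.
  coord-indep : ∀ {is} → Unique is → Indep (map coord is)
  coord-indep []                     = tt
  coord-indep {is = i ∷ is} (i≢ ∷ u) = independent , coord-indep u
    where
    unit : 𝔽₂^ n
    unit = replicate n false [ i ]≔ true
    coord-unit : ∀ j → coord j (L unit) ≡ lookup unit j
    coord-unit j = cong (λ w → lookup w j) (left unit)
    vanish : ∀ {j} → i ≢ j → coord j (L unit) ≡ false
    vanish {j} ne = ≡.trans (coord-unit j)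
      (≡.trans (lookup∘update′ (ne ∘ sym) (replicate n false) true) (lookup-replicate j false))
    independent : ¬ Span (map coord is) (coord i)
    independent s
      with () ← ≡.trans (sym (Span-vanishes (All.map⁺ (All.map vanish i≢)) s))
                        (≡.trans (coord-unit i) (lookup∘update i (replicate n false) true))

-- Surjectivity supplies the inverse; injectivity gives the left inverse law and additivity after
-- applying `L`.
linearInverse : ∀ {L : 𝔽₂^ n → 𝔽₂^ n} → IsInvertibleLinear L → LinearInverse L
linearInverse {L = L} iso = record
  { inv   = inv
  ; left  = λ x → injective (right (L x))
  ; right = right
  ; homo  = λ y z → injective (≡.trans (right (y ⊞ z))
      (sym (≡.trans (+ᴹ-homo (inv y) (inv z)) (cong₂ _⊞_ (right y) (right z)))))
  }
  where
  open LeftModuleMorphisms.IsLeftModuleIsomorphism iso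
  inv = λ y → proj₁ (surjective y)
  right : ∀ y → L (inv y) ≡ y
  right y = proj₂ (surjective y) refl

-- Conditions that survive translation by `u`.

single : ∀ {L : 𝔽₂^ n → 𝔽₂^ n} → LinearInverse L → 𝔽₂^ n → Fin n → Functional n × 𝔽₂
single M x i = LinearInverse.coord M i , not (lookup x i)

-- The prescribed sum says that exactly one of the two coordinates disagrees with `x`, without
-- fixing which.
pair : ∀ {L : 𝔽₂^ n → 𝔽₂^ n} → LinearInverse L → 𝔽₂^ n → Fin n × Fin n → Functional n × 𝔽₂
pair M x (i , j) = pairSum (LinearInverse.coord M) (i , j) , not (lookup x i xor lookup x j)

pairSum-linear : ∀ {L : 𝔽₂^ n → 𝔽₂^ n} (M : LinearInverse L) ij →
  Linear (pairSum (LinearInverse.coord M) ij)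
pairSum-linear M (i , j) y z = ≡.trans (cong₂ _xor_ (coord-linear i y z) (coord-linear j y z))
  (xor-interchange (coord i y) (coord i z) (coord j y) (coord j z))
  where open LinearInverse M

Holds : 𝔽₂^ n → Functional n × 𝔽₂ → Set
Holds y (φ , b) = φ y ≡ b

module _ {L : 𝔽₂^ n → 𝔽₂^ n} (M : LinearInverse L) (x u y : 𝔽₂^ n) where
  open LinearInverse M

  private
    xor-not : ∀ a → a xor not a ≡ true
    xor-not true  = refl
    xor-not false = refl

  good-single : ∀ {i} → coord i u ≡ false → Holds y (single M x i) →
    ∀ {y′} → y′ ≡ y ⊎ y′ ≡ y ⊞ u → lookup x i xor coord i y′ ≡ true
  good-single {i} off h {y′} c = ≡.trans
    (cong (lookup x i xor_) (≡.trans (invariant c) h)) (xor-not (lookup x i))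
    where
    invariant : y′ ≡ y ⊎ y′ ≡ y ⊞ u → coord i y′ ≡ coord i y
    invariant (inj₁ refl) = refl
    invariant (inj₂ refl) = ≡.trans (coord-linear i y u)
      (≡.trans (cong (coord i y xor_) off) (xor-identityʳ (coord i y)))

  -- Translation by `u` flips both coordinates and therefore preserves their sum.
  good-pair : ∀ {i j} → coord i u ≡ true → coord j u ≡ true → Holds y (pair M x (i , j)) →
    ∀ {y′} → y′ ≡ y ⊎ y′ ≡ y ⊞ u →
    (lookup x i xor coord i y′) xor (lookup x j xor coord j y′) ≡ true
  good-pair {i} {j} oni onj h {y′} c = ≡.trans
    (xor-interchange (lookup x i) (coord i y′) (lookup x j) (coord j y′))
    (≡.trans (cong ((lookup x i xor lookup x j) xor_) (≡.trans (invariant c) h))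
      (xor-not (lookup x i xor lookup x j)))
    where
    invariant : y′ ≡ y ⊎ y′ ≡ y ⊞ u → coord i y′ xor coord j y′ ≡ coord i y xor coord j y
    invariant (inj₁ refl) = refl
    invariant (inj₂ refl) = ≡.trans (pairSum-linear M (i , j) y u)
      (≡.trans (cong₂ (λ a b → (coord i y xor coord j y) xor (a xor b)) oni onj)
        (xor-identityʳ (coord i y xor coord j y)))

  far : (S : Selection (λ i → coord i u) (allFin n)) →
    All (Holds y) (map (pair M x) (Selection.pairs S)) →
    All (Holds y) (map (single M x) (Selection.singles S)) →
    ∀ {y′} → y′ ≡ y ⊎ y′ ≡ y ⊞ u → n ≤ 6 + 2 * d x (inv y′)
  far S hp hs {y′} c = subst (_≤ 6 + 2 * d x (inv y′)) (length-tabulate id)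
    (subst (λ k → length (allFin n) ≤ 6 + 2 * k) (sym (d≡tally x (inv y′)))
      (tally-selection S (λ i → lookup x i xor coord i y′)
        (All.zipWith (λ (off , h) → good-single off h c) (S.singles-off , All.map⁻ hs))
        (All.zipWith (λ ((oni , onj) , h) → good-pair oni onj h c) (S.pairs-on , All.map⁻ hp))))
    where module S = Selection S

module _ {L₁ L₂ : 𝔽₂^ n → 𝔽₂^ n} (M₁ : LinearInverse L₁) (M₂ : LinearInverse L₂) (x₁ x₂ u : 𝔽₂^ n) where
  private
    module M₁ = LinearInverse M₁
    module M₂ = LinearInverse M₂

  -- Keeping both `y` and its translate far from the first two centres leaves the choice between
  -- them free for the third.
  Balanced : 𝔽₂^ n → Set
  Balanced y = ∀ {y′} → y′ ≡ y ⊎ y′ ≡ y ⊞ u →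
    n ≤ 6 + 2 * d x₁ (M₁.inv y′) × n ≤ 6 + 2 * d x₂ (M₂.inv y′)

  realise : (S : Selection (λ i → M₁.coord i u) (allFin n)) (T : Selection (λ i → M₂.coord i u) (allFin n)) →
    let open Selection in
    Indep (map (pairSum M₂.coord) (pairs T) ++ map (pairSum M₁.coord) (pairs S) ++
           map M₁.coord (singles S) ++ map M₂.coord (singles T)) →
    ∃[ y ] Balanced y
  realise S T ind with solvable (cs₁ ++ cs₂ ++ cs₃ ++ cs₄) linear (subst Indep (sym functionals) ind)
    where
    module S = Selection S
    module T = Selection T
    cs₁ cs₂ cs₃ cs₄ : List (Functional n × 𝔽₂)
    cs₁ = map (pair M₂ x₂) T.pairs
    cs₂ = map (pair M₁ x₁) S.pairs
    cs₃ = map (single M₁ x₁) S.singles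
    cs₄ = map (single M₂ x₂) T.singles

    functionals : map proj₁ (cs₁ ++ cs₂ ++ cs₃ ++ cs₄) ≡
      map (pairSum M₂.coord) T.pairs ++ map (pairSum M₁.coord) S.pairs ++
      map M₁.coord S.singles ++ map M₂.coord T.singles
    functionals =
      ≡.trans (map-++ proj₁ cs₁ (cs₂ ++ cs₃ ++ cs₄)) (cong₂ _++_ (sym (map-∘ T.pairs))
      (≡.trans (map-++ proj₁ cs₂ (cs₃ ++ cs₄)) (cong₂ _++_ (sym (map-∘ S.pairs))
      (≡.trans (map-++ proj₁ cs₃ cs₄) (cong₂ _++_ (sym (map-∘ S.singles)) (sym (map-∘ T.singles)))))))

    linear : All (Linear ∘ proj₁) (cs₁ ++ cs₂ ++ cs₃ ++ cs₄)
    linear = All.++⁺ (All.map⁺ (All.universal (pairSum-linear M₂) T.pairs))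
            (All.++⁺ (All.map⁺ (All.universal (pairSum-linear M₁) S.pairs))
            (All.++⁺ (All.map⁺ (All.universal M₁.coord-linear S.singles))
                     (All.map⁺ (All.universal M₂.coord-linear T.singles))))
  ... | y , solved = y , λ c → far M₁ x₁ u y S hp₁ hs₁ c , far M₂ x₂ u y T hp₂ hs₂ c
    where
    module S = Selection S
    module T = Selection T
    hp₂ = All.++⁻ˡ (map (pair M₂ x₂) T.pairs) solved
    tail₁ = All.++⁻ʳ (map (pair M₂ x₂) T.pairs) solved
    hp₁ = All.++⁻ˡ (map (pair M₁ x₁) S.pairs) tail₁
    tail₂ = All.++⁻ʳ (map (pair M₁ x₁) S.pairs) tail₁
    hs₁ = All.++⁻ˡ (map (single M₁ x₁) S.singles) tail₂
    hs₂ = All.++⁻ʳ (map (single M₁ x₁) S.singles) tail₂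

  balanced-point : ∃[ y ] Balanced y
  balanced-point =
    let S , T , ind = select M₁.coord M₂.coord (λ i → M₁.coord i u) (λ i → M₂.coord i u) (allFin n)
                        (M₁.coord-indep (allFin⁺ n)) (M₂.coord-indep (allFin⁺ n))
    in realise S T ind

-- The third ball.

d-complement : (x z : 𝔽₂^ n) → d x z + d x (z ⊞ replicate n true) ≡ n
d-complement {n} x z = ≡.trans (cong₂ _+_ (d≡tally x z) (≡.trans (d≡tally x (z ⊞ replicate n true))
  (tally-cong flipped (allFin n)))) (≡.trans (tally-not _ (allFin n)) (length-tabulate id))
  where
  flipped : ∀ i → lookup x i xor lookup (z ⊞ replicate n true) i ≡ not (lookup x i xor lookup z i)
  flipped i = ≡.trans
    (cong (lookup x i xor_) (≡.trans (lookup-zipWith _xor_ i z (replicate n true))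
      (cong (lookup z i xor_) (lookup-replicate i true))))
    (≡.trans (sym (xor-assoc (lookup x i) (lookup z i) true)) (xor-comm _ true))

module _ {L₁ L₂ L₃ : 𝔽₂^ n → 𝔽₂^ n}
  (M₁ : LinearInverse L₁) (M₂ : LinearInverse L₂) (M₃ : LinearInverse L₃) (x₁ x₂ x₃ : 𝔽₂^ n) where
  private
    module M₁ = LinearInverse M₁
    module M₂ = LinearInverse M₂
    module M₃ = LinearInverse M₃

    u : 𝔽₂^ n
    u = L₃ (replicate n true)

    antipodal : ∀ y → d x₃ (M₃.inv y) + d x₃ (M₃.inv (y ⊞ u)) ≡ n
    antipodal y = ≡.trans
      (cong (λ w → d x₃ (M₃.inv y) + d x₃ w)
        (≡.trans (M₃.homo y u) (cong (M₃.inv y ⊞_) (M₃.left (replicate n true)))))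
      (d-complement x₃ (M₃.inv y))

    half : ∀ {a b} → a + b ≡ n → b ≤ a → n ≤ 6 + 2 * a
    half {a} eq le = ≤-trans (≤-reflexive (sym eq))
      (≤-trans (+-monoʳ-≤ a (≤-trans le (≤-reflexive (sym (+-identityʳ a))))) (m≤n+m (2 * a) 6))

  FarFromAll : 𝔽₂^ n → Set
  FarFromAll y =
    n ≤ 6 + 2 * d x₁ (M₁.inv y) × n ≤ 6 + 2 * d x₂ (M₂.inv y) × n ≤ 6 + 2 * d x₃ (M₃.inv y)

  -- By `antipodal` the two candidate distances to `x₃` add up to n, so the larger is at least n/2.
  farFromThird : ∀ {y} → Balanced M₁ M₂ x₁ x₂ u y → ∃[ y′ ] FarFromAll y′
  farFromThird {y} bal with ≤-total (d x₃ (M₃.inv (y ⊞ u))) (d x₃ (M₃.inv y))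
  ... | inj₁ le = y , proj₁ (bal (inj₁ refl)) , proj₂ (bal (inj₁ refl)) , half (antipodal y) le
  ... | inj₂ le = y ⊞ u , proj₁ (bal (inj₂ refl)) , proj₂ (bal (inj₂ refl)) ,
    half (≡.trans (+-comm (d x₃ (M₃.inv (y ⊞ u))) (d x₃ (M₃.inv y))) (antipodal y)) le

  uncovered : ∃[ y ] FarFromAll y
  uncovered = farFromThird (proj₂ (balanced-point M₁ M₂ x₁ x₂ u))

-- From integer bounds to real radii.

-- The 14 is 2 · 7 after clearing denominators. Unnormalised rationals reduce the claim to an
-- inequality of integers.
n/2-7≤m : ∀ n m → n ≤ 14 + 2 * m → + n / 2 - + 7 / 1 ℚ.≤ + m / 1
n/2-7≤m n m le = ℚ.toℚᵘ-cancel-≤ (begin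
  toℚᵘ (+ n / 2 - + 7 / 1)                      ≃⟨ ℚ.toℚᵘ-homo-+ (+ n / 2) (ℚ.- (+ 7 / 1)) ⟩
  toℚᵘ (+ n / 2) ℚᵘ.+ toℚᵘ (ℚ.- (+ 7 / 1))      ≃⟨ ℚᵘ.+-congˡ _ (ℚ.toℚᵘ-fromℚᵘ (mkℚᵘ (+ n) 1)) ⟩
  mkℚᵘ (+ n) 1 ℚᵘ.+ mkℚᵘ (-[1+ 6 ]) 0           ≤⟨ *≤* scaled ⟩
  mkℚᵘ (+ m) 0                                  ≃⟨ ℚ.toℚᵘ-fromℚᵘ (mkℚᵘ (+ m) 0) ⟨
  toℚᵘ (+ m / 1)                                ∎)
  where
  open ℚᵘ.≤-Reasoning
  shifted : ∀ k → (+ 14 ℤ.+ + 2 ℤ.* k) ℤ.+ -[1+ 13 ] ≡ k ℤ.* + 2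
  shifted = ℤ.solve-∀
  scaled : (+ n ℤ.* + 1 ℤ.+ -[1+ 6 ] ℤ.* + 2) ℤ.* + 1 ℤ.≤ + m ℤ.* + 2
  scaled = ≡.subst₂ ℤ._≤_
    (sym (≡.trans (ℤ.*-identityʳ _) (cong (ℤ._+ -[1+ 13 ]) (ℤ.*-identityʳ (+ n)))))
    (≡.trans (cong (λ k → + 14 ℤ.+ k ℤ.+ -[1+ 13 ]) (ℤ.pos-* 2 m)) (shifted (+ m)))
    (ℤ.+-monoˡ-≤ -[1+ 13 ] (ℤ.+≤+ le))

outside-ball : ∀ {L : 𝔽₂^ n → 𝔽₂^ n} (M : LinearInverse L) x r {y} →
  r <ℝ fromℚ (+ n / 2 - + 7 / 1) →
  n ≤ 6 + 2 * d x (LinearInverse.inv M y) → ¬ y ∈ image L (B r x)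
outside-ball {n} M x r (q , q>r , q<) le (w , w∈B , refl) =
  -- The rational `q` separating `r` from n/2 - 7 also lies below the distance, contradicting `w∈B`.
  -- The 8 is the slack between 14 and the 6 obtained from the selection.
  w∈B (q , q>r , ℚ.<-≤-trans q< (n/2-7≤m n (d x w)
    (≤-trans (subst (λ v → n ≤ 6 + 2 * d x v) (left w) le) (m≤n+m (6 + 2 * d x w) 8))))
  where open LinearInverse M

mainTheorem3 : ∃[ n₀ ] ∀ (n : ℕ) → n ≥ n₀ →
    ∀ (r : ℝ) → r <ℝ fromℚ (+ n / 2 - + 7 / 1) →
    ∀ (L₁ L₂ L₃ : 𝔽₂^ n → 𝔽₂^ n) →
    IsInvertibleLinear L₁ → IsInvertibleLinear L₂ → IsInvertibleLinear L₃ →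
    ∀ (x₁ x₂ x₃ : 𝔽₂^ n) →
    ¬ ((image L₁ (B r x₁) ∪ image L₂ (B r x₂) ∪ image L₃ (B r x₃)) ≐ U)
-- `uncovered` produces its point in every dimension, whence the witness 0.
mainTheorem3 = 0 , λ n _ r r< L₁ L₂ L₃ iso₁ iso₂ iso₃ x₁ x₂ x₃ (_ , covers) →
  let M₁ = linearInverse iso₁
      M₂ = linearInverse iso₂
      M₃ = linearInverse iso₃
      y , far₁ , far₂ , far₃ = uncovered M₁ M₂ M₃ x₁ x₂ x₃
  in [ outside-ball M₁ x₁ r r< far₁
     , [ outside-ball M₂ x₂ r r< far₂ , outside-ball M₃ x₃ r r< far₃ ]′ ]′ (covers {y} tt)
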